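{- Let $S$ be a commutative semiring and $\Sigma$ an alphabet. A weighted language $s:\Sigma^*\to S$ is recognized by a weighted alternating finite automaton (WAFA) over $S$ and $\Sigma$ if and only if there exist a ranked alphabet $\Gamma$, a tree homomorphism $h:\Sigma^*\to T_\Gamma$, and a weighted finite tree automaton (WFTA) $\mathcal A=(Q,\Gamma,\delta,\lambda)$ over $S$ such that $s=[\![\mathcal A]\!]\circ h$.
   Context: An alphabet is a finite non-empty set; $\Sigma^*$ is the set of finite words over $\Sigma$, $\varepsilon$ the empty word. A semiring $(S,+,\cdot,0,1)$ has $(S,+,0)$ a commutative monoid, $(S,\cdot,1)$ a monoid, $0$ absorbing, and both distributive laws; it is commutative if $\cdot$ is commutative. For a finite linearly ordered set $Q=\{q_1,\dots,q_n\}$, $S[Q]$ is the semiring of polynomials with coefficients in $S$ in commuting indeterminates $q_1,\dots,q_n$, and $p\langle s_1,\dots,s_n\rangle$ denotes simultaneous substitution of $s_i$ for $q_i$ in $p$. WAFA. A weighted alternating finite automaton over $S$ and $\Sigma$ is a tuple $\mathcal A=(Q,\Sigma,\delta,P_0,\tau)$ with $Q=\{q_1,\dots,q_n\}$ a finite set of states, $\delta:Q\times\Sigma\to S[Q]$, $P_0\in S[Q]$, $\tau:Q\to S$. Its state behavior is $[\mathcal A]_q(\varepsilon)=\tau(q)$ and $[\mathcal A]_q(av)=\delta(q,a)\langle[\mathcal A]_{q_1}(v),\dots,[\mathcal A]_{q_n}(v)\rangle$ for $a\in\Sigma$, $v\in\Sigma^*$. Its behavior is $[\![\mathcal A]\!](w)=P_0\langle[\mathcal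 A]_{q_1}(w),\dots,[\mathcal A]_{q_n}(w)\rangle$. $\mathcal A$ recognizes $s:\Sigma^*\to S$ if $[\![\mathcal A]\!]=s$. Trees. A ranked alphabet is an alphabet $\Gamma$ with a map $\mathrm{Rank}:\Gamma\to\mathbb N$; $\Gamma^{(k)}$ is the set of symbols of rank $k$, $\mathrm{Rank}(\Gamma)$ the maximal rank. $T_\Gamma[X_n]$ is the set of (finite, ranked) $\Gamma$-terms/trees over variables $x_1,\dots,x_n$ (variables have rank $0$ and are not in $\Gamma$), and $T_\Gamma$ is the set of such trees without variables. $t\langle t_1,\dots,t_n\rangle$ denotes simultaneous substitution of $t_i$ for all occurrences of $x_i$. Tree homomorphism from words. A tree homomorphism $h:T_\Lambda\to T_\Gamma$ is a map such that for each $g\in\Lambda^{(r)}$ there is a tree $h(g)\in T_\Gamma[X_r]$ with $h(g(t_1,\dots,t_r))=h(g)\langle h(t_1),\dots,h(t_r)\rangle$ for all $t_1,\dots,t_r\in T_\Lambda$. Words over $\Sigma$ are identified with trees over the ranked alphabet $\Sigma^1_\#=\Sigma\cup\{\#\}$, where $\#\notin\Sigma$ has rank $0$ and every letter of $\Sigma$ has rank $1$ ($w_1\cdots w_m$ corresponds to $w_1(\cdots w_m(\#)\cdots)$). Thus a tree homomorphism $h:\Sigma^*\to T_\Gamma$ is given by a tree $h(\#)\in T_\Gamma$ and trees $h(a)\in T_\Gamma[\{x_1\}]$ ($a\in\Sigma$), with $h(\varepsilon)=h(\#)$ and $h(av)=h(a)\langle h(v)\rangle$. WFTA. A weighted finite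 tree automaton over $S$ is $\mathcal A=(Q,\Gamma,\delta,\lambda)$ with $Q$ a finite set of states, $\Gamma$ a ranked alphabet, $\delta=(\delta_k)_{0\le k\le \mathrm{Rank}(\Gamma)}$ with $\delta_k:\Gamma^{(k)}\to S^{Q^k\times Q}$ (write $\delta_g$ for $\delta_k(g)$), and $\lambda:Q\to S$. Its state behavior is $[\mathcal A]_q(g(t_1,\dots,t_k))=\sum_{(p_1,\dots,p_k)\in Q^k}\delta_g((p_1,\dots,p_k),q)\cdot\prod_{i=1}^k[\mathcal A]_{p_i}(t_i)$, and its behavior is $[\![\mathcal A]\!]:T_\Gamma\to S$, $[\![\mathcal A]\!](t)=\sum_{q\in Q}\lambda(q)\cdot[\mathcal A]_q(t)$. -}

module Defs where

open import Algebra.Bundles using (CommutativeSemiring)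
import Algebra.Definitions.RawSemiring as RawSemiringDefinitions
open import Data.Fin.Base using (Fin; zero; suc)
open import Data.List.Base using (List; []; _∷_; foldr)
open import Data.Maybe.Base using (Maybe; just; nothing)
open import Data.Nat.Base using (ℕ; zero; suc)
open import Data.Product.Base using (_×_; _,_)
open import Data.Vec.Base using (Vec; []; _∷_; lookup; map)
open import Function.Bundles using (_↔_; Inverse; mk↔ₛ′)
open import Level using (Level)
open import Relation.Binary.PropositionalEquality using (_≡_; refl; cong)

record Alphabet : Set₁ where
  field
    Symbol      : Set
    {size-1}    : ℕ
    enumeration : Symbol ↔ Fin (suc size-1)

open Alphabet public using (Symbol)

Word : Alphabet → Set
Word Σ = List (Symbol Σ)

record RankedAlphabet : Set₁ where
  field
    alphabet : Alphabet
    rank     : Symbol alphabet → ℕ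

  open Alphabet alphabet public

open RankedAlphabet public using (rank)

-- Tree Γ n is T_Γ[X_n]; the variables x₁,…,xₙ are indexed by Fin n.
data Tree (Γ : RankedAlphabet) (n : ℕ) : Set where
  var  : Fin n → Tree Γ n
  node : (g : RankedAlphabet.Symbol Γ) → Vec (Tree Γ n) (rank Γ g) → Tree Γ n

GroundTree : RankedAlphabet → Set
GroundTree Γ = Tree Γ 0

module _ {Γ : RankedAlphabet} {m n : ℕ} where

  infix 8 _⟨_⟩ _⟨_⟩*

  _⟨_⟩  : Tree Γ m → Vec (Tree Γ n) m → Tree Γ n
  _⟨_⟩* : ∀ {k} → Vec (Tree Γ m) k → Vec (Tree Γ n) m → Vec (Tree Γ n) k

  var i     ⟨ us ⟩ = lookup us i
  node g ts ⟨ us ⟩ = node g (ts ⟨ us ⟩*)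

  []       ⟨ us ⟩* = []
  (t ∷ ts) ⟨ us ⟩* = t ⟨ us ⟩ ∷ ts ⟨ us ⟩*

record TreeHomomorphism (Λ Γ : RankedAlphabet) : Set where
  field
    apply       : GroundTree Λ → GroundTree Γ
    image       : (g : RankedAlphabet.Symbol Λ) → Tree Γ (rank Λ g)
    homomorphic : ∀ g (ts : Vec (GroundTree Λ) (rank Λ g)) →
                  apply (node g ts) ≡ image g ⟨ map apply ts ⟩

open TreeHomomorphism public using (apply)

-- Σ ∪ {#}: `nothing` is the fresh end marker # of rank 0, and every
-- letter `just a` has rank 1.
_^1# : Alphabet → RankedAlphabet
Σ ^1# = record
  { alphabet = record
    { Symbol      = Maybe (Symbol Σ)
    ; enumeration = mk↔ₛ′ to′ from′ to′∘from′ from′∘to′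
    }
  ; rank = λ { nothing → 0 ; (just _) → 1 }
  }
  where
  open Alphabet Σ using (size-1; enumeration)
  open Inverse enumeration using (to; from; strictlyInverseˡ; strictlyInverseʳ)

  to′ : Maybe (Symbol Σ) → Fin (suc (suc size-1))
  to′ nothing  = zero
  to′ (just a) = suc (to a)

  from′ : Fin (suc (suc size-1)) → Maybe (Symbol Σ)
  from′ zero    = nothing
  from′ (suc i) = just (from i)

  to′∘from′ : ∀ i → to′ (from′ i) ≡ i
  to′∘from′ zero    = refl
  to′∘from′ (suc i) = cong suc (strictlyInverseˡ i)

  from′∘to′ : ∀ x → from′ (to′ x) ≡ x
  from′∘to′ nothing  = refl
  from′∘to′ (just a) = cong just (strictlyInverseʳ a)

wordTree : ∀ Σ → Word Σ → GroundTree (Σ ^1#)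
wordTree Σ []      = node nothing []
wordTree Σ (a ∷ w) = node (just a) (wordTree Σ w ∷ [])

module _ {c ℓ : Level} (S : CommutativeSemiring c ℓ) where

  open CommutativeSemiring S
  open RawSemiringDefinitions rawSemiring using (sum; product; _^_)

  WeightedLanguage : Alphabet → Set c
  WeightedLanguage Σ = Word Σ → Carrier

  SameLanguage : ∀ Σ → WeightedLanguage Σ → WeightedLanguage Σ → Set ℓ
  SameLanguage Σ s t = ∀ w → s w ≈ t w

  -- An element of S[q₁,…,qₙ] is given as a finite list of terms
  -- (s , (e₁,…,eₙ)), read as the sum of the s · q₁^e₁ ⋯ qₙ^eₙ.  Exponent
  -- vectors may repeat and coefficients may be zero, so one polynomial has
  -- many presentations; substitution takes the same value on all of them.
  Polynomial : ℕ → Set c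
  Polynomial n = List (Carrier × Vec ℕ n)

  substitute : ∀ {n} → Polynomial n → (Fin n → Carrier) → Carrier
  substitute p x =
    foldr (λ (s , e) r → s * product (λ i → x i ^ lookup e i) + r) 0# p

  -- Sum over all k-tuples in (Fin n)^k.
  sumTuples : ∀ {n} k → (Vec (Fin n) k → Carrier) → Carrier
  sumTuples zero    f = f []
  sumTuples (suc k) f = sum (λ p → sumTuples k (λ ps → f (p ∷ ps)))

  -- In both kinds of automata the finite state set {q₁,…,qₙ} is Fin n.
  record WAFA (Σ : Alphabet) : Set c where
    field
      {states} : ℕ
      δ        : Fin states → Symbol Σ → Polynomial states
      P₀       : Polynomial states
      τ        : Fin states → Carrier

    stateBehavior : Word Σ → Fin states → Carrier
    stateBehavior []      q = τ q
    stateBehavior (a ∷ v) q = substitute (δ q a) (stateBehavior v)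

    behavior : WeightedLanguage Σ
    behavior w = substitute P₀ (stateBehavior w)

  Recognizes : ∀ {Σ} → WAFA Σ → WeightedLanguage Σ → Set ℓ
  Recognizes {Σ} 𝓐 s = SameLanguage Σ (WAFA.behavior 𝓐) s

  record WFTA (Γ : RankedAlphabet) : Set c where
    field
      {states} : ℕ
      δ        : (g : RankedAlphabet.Symbol Γ) →
                 Vec (Fin states) (rank Γ g) → Fin states → Carrier
      final    : Fin states → Carrier

    stateBehavior : GroundTree Γ → Fin states → Carrier
    -- childProduct (t₁,…,tₖ) (p₁,…,pₖ) = ∏ᵢ [𝓐]_{pᵢ}(tᵢ)
    childProduct  : ∀ {k} → Vec (GroundTree Γ) k → Vec (Fin states) k → Carrier

    stateBehavior (node g ts) q =
      sumTuples (rank Γ g) (λ ps → δ g ps q * childProduct ts ps)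

    childProduct []       []       = 1#
    childProduct (t ∷ ts) (p ∷ ps) = stateBehavior t p * childProduct ts ps

    behavior : GroundTree Γ → Carrier
    behavior t = sum (λ q → final q * stateBehavior t q)

-- From a tree automaton and h: reading h(a)⟨u⟩ from state q is a polynomial in
-- the state weights of u, so these polynomials are the transitions of a WAFA.
--
-- From a WAFA: after adding a state ⊥ of constant weight 1 and a state whose
-- weight is the whole behavior (its transition is P₀ composed with δ), every
-- monomial can be padded with ⊥ to a product of exactly k_a states, where k_a
-- bounds the degrees of all δ(q,a).  The homomorphism h(#) = #,
-- h(a) = a(x₁,…,x₁) makes k_a copies, and a tree automaton multiplies their
-- weights with the coefficients of δ(q,a).
module Submission where

open import Defs
open import Algebra.Bundles using (CommutativeSemiring; RawSemiring)
import Algebra.Definitions.RawSemiring as RawSemiringDefinitions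
import Algebra.Properties.CommutativeMonoid.Sum as CommutativeMonoidSum
import Algebra.Properties.CommutativeSemigroup as CommutativeSemigroupProperties
import Algebra.Properties.Semiring.Exp as SemiringExp
import Algebra.Properties.Semiring.Sum as SemiringSum
open import Data.Fin.Base using (Fin; zero; suc)
open import Data.List.Base as List
  using (List; []; _∷_; _++_; length; foldr; concat; cartesianProductWith)
open import Data.List.Extrema.Nat using (max; xs≤max)
open import Data.List.Relation.Unary.All using (All; []; _∷_)
import Data.List.Relation.Unary.All.Properties as All
open import Data.Maybe.Base using (just; nothing)
open import Data.Nat.Base using (ℕ; zero; suc; _≤_; z≤n; s≤s)
import Data.Nat.Base as ℕ
open import Data.Product.Base using (Σ-syntax; _×_; _,_)
open import Data.Vec.Base using (Vec; []; _∷_; lookup; replicate; zipWith; _[_]≔_)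
open import Data.Vec.Properties using (lookup-replicate; lookup-zipWith)
open import Function.Base using (_∘_)
open import Function.Bundles using (_⇔_; mk⇔)
open import Level using (_⊔_)
open import Relation.Binary.PropositionalEquality as ≡ using (_≡_)
import Relation.Binary.Reasoning.Setoid as SetoidReasoning

module _ {c ℓ} (S : CommutativeSemiring c ℓ) where

  open CommutativeSemiring S hiding (zero)
  open RawSemiringDefinitions rawSemiring using (sum; product; _^_)
  open SemiringSum semiring using (sum-cong-≋; *-distribˡ-sum; ∑-distrib-+; sum-replicate-zero)
  open SemiringExp semiring using (^-congˡ; ^-homo-*)
  open CommutativeSemigroupProperties *-commutativeSemigroup using (interchange)
  open SetoidReasoning setoid
  private
    -- A finite product in `S` is a finite sum in its multiplicative monoid, so the facts about sums
    -- in this module are facts about `product`.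
    module Product = CommutativeMonoidSum *-commutativeMonoid

  private
    Monomial : ℕ → Set c
    Monomial n = Carrier × Vec ℕ n

    _⟪_⟫ : ∀ {n} → Polynomial S n → (Fin n → Carrier) → Carrier
    _⟪_⟫ = substitute S

    power : ∀ {n} → Vec ℕ n → (Fin n → Carrier) → Carrier
    power e x = product (λ i → x i ^ lookup e i)

    monomial : ∀ {n} → Monomial n → (Fin n → Carrier) → Carrier
    monomial (s , e) x = s * power e x

  substitute-cong : ∀ {n} (p : Polynomial S n) {x y : Fin n → Carrier} →
                    (∀ i → x i ≈ y i) → p ⟪ x ⟫ ≈ p ⟪ y ⟫
  substitute-cong []            x≈y = refl
  substitute-cong {n} ((s , e) ∷ p) x≈y =
    +-cong (*-congˡ (Product.sum-cong-≋ {n} λ i → ^-congˡ (lookup e i) (x≈y i)))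
           (substitute-cong p x≈y)

  -- Polynomial arithmetic

  constant : ∀ {n} → Carrier → Polynomial S n
  constant s = (s , replicate _ 0) ∷ []

  indeterminate : ∀ {n} → Fin n → Polynomial S n
  indeterminate i = (1# , replicate _ 0 [ i ]≔ 1) ∷ []

  infixl 7 _·_
  _·_ : ∀ {n} → Monomial n → Monomial n → Monomial n
  (s , e) · (t , f) = s * t , zipWith ℕ._+_ e f

  -- Packaging the operations this way yields `ℙ.sum`, `ℙ.product` and `ℙ._^_` from the same generic
  -- definitions as in `S`, so each substitution lemma below follows the same recursion on both
  -- sides. Two presentations count as equal when they agree as functions.
  polynomialRawSemiring : ℕ → RawSemiring c (c ⊔ ℓ)
  polynomialRawSemiring n = record
    { Carrier = Polynomial S n
    ; _≈_     = λ p q → ∀ x → p ⟪ x ⟫ ≈ q ⟪ x ⟫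
    ; _+_     = _++_
    ; _*_     = cartesianProductWith _·_
    ; 0#      = []
    ; 1#      = constant 1#
    }

  private
    module ℙ {n : ℕ} where
      open RawSemiring (polynomialRawSemiring n) public using (_+_; _*_; 1#)
      open RawSemiringDefinitions (polynomialRawSemiring n) public using (sum; product; _^_)

  substitute-+ : ∀ {n} (p q : Polynomial S n) x → (p ℙ.+ q) ⟪ x ⟫ ≈ p ⟪ x ⟫ + q ⟪ x ⟫
  substitute-+ []      q x = sym (+-identityˡ _)
  substitute-+ (m ∷ p) q x = trans (+-congˡ (substitute-+ p q x)) (sym (+-assoc _ _ _))

  power-0 : ∀ {n} (x : Fin n → Carrier) → power (replicate n 0) x ≈ 1#
  power-0 {n} x = begin
    power (replicate n 0) x  ≈⟨ Product.sum-cong-≋ {n} (λ i → reflexive (≡.cong (x i ^_) (lookup-replicate i 0))) ⟩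
    product {n} (λ _ → 1#)   ≈⟨ Product.sum-replicate-zero n ⟩
    1#                       ∎

  substitute-constant : ∀ {n} s (x : Fin n → Carrier) → constant s ⟪ x ⟫ ≈ s
  substitute-constant s x = begin
    s * power (replicate _ 0) x + 0#  ≈⟨ +-identityʳ _ ⟩
    s * power (replicate _ 0) x       ≈⟨ *-congˡ (power-0 x) ⟩
    s * 1#                            ≈⟨ *-identityʳ s ⟩
    s                                 ∎

  power-unit : ∀ {n} (i : Fin n) x → power (replicate n 0 [ i ]≔ 1) x ≈ x i
  power-unit zero x =
    trans (*-cong (*-identityʳ (x zero)) (power-0 (x ∘ suc))) (*-identityʳ _)
  power-unit (suc i) x = trans (*-identityˡ _) (power-unit i (x ∘ suc))

  substitute-indeterminate : ∀ {n} (i : Fin n) x → indeterminate i ⟪ x ⟫ ≈ x i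
  substitute-indeterminate i x =
    trans (+-identityʳ _) (trans (*-identityˡ _) (power-unit i x))

  -- Exponents add coordinate by coordinate; splitting the resulting product into two rests on the
  -- commutativity of `S`.
  power-+ : ∀ {n} (e f : Vec ℕ n) x → power (zipWith ℕ._+_ e f) x ≈ power e x * power f x
  power-+ {n} e f x = begin
    power (zipWith ℕ._+_ e f) x
      ≈⟨ Product.sum-cong-≋ {n} (λ i → trans
           (reflexive (≡.cong (x i ^_) (lookup-zipWith ℕ._+_ i e f)))
           (^-homo-* (x i) (lookup e i) (lookup f i))) ⟩
    product (λ i → x i ^ lookup e i * x i ^ lookup f i)
      ≈⟨ Product.∑-distrib-+ {n} (λ i → x i ^ lookup e i) (λ i → x i ^ lookup f i) ⟩
    power e x * power f x
      ∎

  monomial-· : ∀ {n} (m m′ : Monomial n) x → monomial (m · m′) x ≈ monomial m x * monomial m′ x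
  monomial-· (s , e) (t , f) x = trans (*-congˡ (power-+ e f x)) (interchange s t _ _)

  substitute-map-· : ∀ {n} (m : Monomial n) p x →
                     List.map (m ·_) p ⟪ x ⟫ ≈ monomial m x * p ⟪ x ⟫
  substitute-map-· m []       x = sym (zeroʳ _)
  substitute-map-· m (m′ ∷ p) x =
    trans (+-cong (monomial-· m m′ x) (substitute-map-· m p x)) (sym (distribˡ _ _ _))

  substitute-* : ∀ {n} (p q : Polynomial S n) x → (p ℙ.* q) ⟪ x ⟫ ≈ p ⟪ x ⟫ * q ⟪ x ⟫
  substitute-* []      q x = sym (zeroˡ _)
  substitute-* (m ∷ p) q x = begin
    (List.map (m ·_) q ++ p ℙ.* q) ⟪ x ⟫              ≈⟨ substitute-+ (List.map (m ·_) q) (p ℙ.* q) x ⟩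
    List.map (m ·_) q ⟪ x ⟫ + (p ℙ.* q) ⟪ x ⟫         ≈⟨ +-cong (substitute-map-· m q x) (substitute-* p q x) ⟩
    monomial m x * q ⟪ x ⟫ + p ⟪ x ⟫ * q ⟪ x ⟫        ≈⟨ distribʳ _ _ _ ⟨
    (monomial m x + p ⟪ x ⟫) * q ⟪ x ⟫                ∎

  substitute-^ : ∀ {n} (p : Polynomial S n) d x → (p ℙ.^ d) ⟪ x ⟫ ≈ p ⟪ x ⟫ ^ d
  substitute-^ p zero    x = substitute-constant 1# x
  substitute-^ p (suc d) x = trans (substitute-* p (p ℙ.^ d) x) (*-congˡ (substitute-^ p d x))

  substitute-sum : ∀ {n k} (f : Fin k → Polynomial S n) x →
                   ℙ.sum f ⟪ x ⟫ ≈ sum (λ i → f i ⟪ x ⟫)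
  substitute-sum {k = zero}  f x = refl
  substitute-sum {k = suc k} f x =
    trans (substitute-+ (f zero) (ℙ.sum (f ∘ suc)) x) (+-congˡ (substitute-sum (f ∘ suc) x))

  substitute-product : ∀ {n k} (f : Fin k → Polynomial S n) x →
                       ℙ.product f ⟪ x ⟫ ≈ product (λ i → f i ⟪ x ⟫)
  substitute-product {k = zero}  f x = substitute-constant 1# x
  substitute-product {k = suc k} f x =
    trans (substitute-* (f zero) (ℙ.product (f ∘ suc)) x) (*-congˡ (substitute-product (f ∘ suc) x))

  infixr 9 _⊙_
  -- Composition of polynomials. It serves both to rename states and to push `P₀` through one
  -- transition.
  _⊙_ : ∀ {m n} → Polynomial S m → (Fin m → Polynomial S n) → Polynomial S n
  p ⊙ r = foldr (λ (s , e) q → constant s ℙ.* ℙ.product (λ i → r i ℙ.^ lookup e i) ℙ.+ q) [] p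

  substitute-⊙ : ∀ {m n} (p : Polynomial S m) (r : Fin m → Polynomial S n) x →
                 (p ⊙ r) ⟪ x ⟫ ≈ p ⟪ (λ i → r i ⟪ x ⟫) ⟫
  substitute-⊙ []            r x = refl
  substitute-⊙ {m} ((s , e) ∷ p) r x = begin
    (constant s ℙ.* rᵉ ℙ.+ p ⊙ r) ⟪ x ⟫                     ≈⟨ substitute-+ (constant s ℙ.* rᵉ) (p ⊙ r) x ⟩
    (constant s ℙ.* rᵉ) ⟪ x ⟫ + (p ⊙ r) ⟪ x ⟫               ≈⟨ +-cong (substitute-* (constant s) rᵉ x) (substitute-⊙ p r x) ⟩
    constant s ⟪ x ⟫ * rᵉ ⟪ x ⟫ + p ⟪ (λ i → r i ⟪ x ⟫) ⟫   ≈⟨ +-congʳ (*-cong (substitute-constant s x) rᵉ⟪x⟫) ⟩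
    s * power e (λ i → r i ⟪ x ⟫) + p ⟪ (λ i → r i ⟪ x ⟫) ⟫ ∎
    where
    rᵉ = ℙ.product (λ i → r i ℙ.^ lookup e i)
    rᵉ⟪x⟫ : rᵉ ⟪ x ⟫ ≈ power e (λ i → r i ⟪ x ⟫)
    rᵉ⟪x⟫ = trans (substitute-product (λ i → r i ℙ.^ lookup e i) x)
                  (Product.sum-cong-≋ {m} λ i → substitute-^ (r i) (lookup e i) x)

  -- Sums over tuples

  sumTuples-cong : ∀ {n} k {f g : Vec (Fin n) k → Carrier} →
                   (∀ ps → f ps ≈ g ps) → sumTuples S k f ≈ sumTuples S k g
  sumTuples-cong zero    f≈g = f≈g []
  sumTuples-cong {n} (suc k) f≈g = sum-cong-≋ {n} λ p → sumTuples-cong k λ ps → f≈g (p ∷ ps)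

  sumTuples-0 : ∀ {n} k → sumTuples S {n} k (λ _ → 0#) ≈ 0#
  sumTuples-0 {n} zero    = refl
  sumTuples-0 {n} (suc k) = trans (sum-cong-≋ {n} λ p → sumTuples-0 {n} k) (sum-replicate-zero n)

  sumTuples-+ : ∀ {n} k (f g : Vec (Fin n) k → Carrier) →
                sumTuples S k (λ ps → f ps + g ps) ≈ sumTuples S k f + sumTuples S k g
  sumTuples-+ zero    f g = refl
  sumTuples-+ {n} (suc k) f g =
    trans (sum-cong-≋ {n} λ p → sumTuples-+ k (f ∘ (p ∷_)) (g ∘ (p ∷_))) (∑-distrib-+ {n} _ _)

  *-distribˡ-sumTuples : ∀ {n} k s (f : Vec (Fin n) k → Carrier) →
                         s * sumTuples S k f ≈ sumTuples S k (λ ps → s * f ps)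
  *-distribˡ-sumTuples zero    s f = refl
  *-distribˡ-sumTuples {n} (suc k) s f =
    trans (*-distribˡ-sum {n} s _) (sum-cong-≋ {n} λ p → *-distribˡ-sumTuples k s (f ∘ (p ∷_)))

  -- The Kronecker delta with values in `S`.
  indicator : ∀ {n} → Fin n → Fin n → Carrier
  indicator zero    zero    = 1#
  indicator zero    (suc q) = 0#
  indicator (suc p) zero    = 0#
  indicator (suc p) (suc q) = indicator p q

  sum-indicator : ∀ {n} (q : Fin n) (f : Fin n → Carrier) → sum (λ p → indicator p q * f p) ≈ f q
  sum-indicator {suc n} zero f = begin
    1# * f zero + sum (λ p → 0# * f (suc p))  ≈⟨ +-cong (*-identityˡ _) (sum-cong-≋ {n} λ p → zeroˡ (f (suc p))) ⟩
    f zero + sum {n} (λ _ → 0#)               ≈⟨ +-congˡ (sum-replicate-zero n) ⟩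
    f zero + 0#                               ≈⟨ +-identityʳ _ ⟩
    f zero                                    ∎
  sum-indicator (suc q) f =
    trans (+-cong (zeroˡ _) (sum-indicator q (f ∘ suc))) (+-identityˡ _)

  indicators : ∀ {n k} → Vec (Fin n) k → Vec (Fin n) k → Carrier
  indicators []       []       = 1#
  indicators (p ∷ ps) (q ∷ qs) = indicator p q * indicators ps qs

  -- The delta of the first coordinate does not depend on the remaining ones, so it leaves the inner
  -- sum; the sum then collapses one coordinate at a time.
  sumTuples-indicators : ∀ {n k} (qs : Vec (Fin n) k) (f : Vec (Fin n) k → Carrier) →
                         sumTuples S k (λ ps → indicators ps qs * f ps) ≈ f qs
  sumTuples-indicators []                   f = *-identityˡ _
  sumTuples-indicators {n} {suc k} (q ∷ qs) f = begin
    sum (λ p → sumTuples S k (λ ps → (indicator p q * indicators ps qs) * f (p ∷ ps)))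
      ≈⟨ sum-cong-≋ {n} (λ p → trans
           (sumTuples-cong k λ ps → *-assoc _ _ _)
           (sym (*-distribˡ-sumTuples k (indicator p q) _))) ⟩
    sum (λ p → indicator p q * sumTuples S k (λ ps → indicators ps qs * f (p ∷ ps)))
      ≈⟨ sum-cong-≋ {n} (λ p → *-congˡ (sumTuples-indicators qs (f ∘ (p ∷_)))) ⟩
    sum (λ p → indicator p q * f (p ∷ qs))
      ≈⟨ sum-indicator q (λ p → f (p ∷ qs)) ⟩
    f (q ∷ qs)
      ∎

  -- From tree automata to alternating automata

  sumTuplesₚ : ∀ {m n} k → (Vec (Fin m) k → Polynomial S n) → Polynomial S n
  sumTuplesₚ zero    f = f []
  sumTuplesₚ (suc k) f = ℙ.sum (λ p → sumTuplesₚ k (f ∘ (p ∷_)))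

  substitute-sumTuplesₚ : ∀ {m n} k (f : Vec (Fin m) k → Polynomial S n) x →
                          sumTuplesₚ k f ⟪ x ⟫ ≈ sumTuples S k (λ ps → f ps ⟪ x ⟫)
  substitute-sumTuplesₚ zero    f x = refl
  substitute-sumTuplesₚ {m} (suc k) f x =
    trans (substitute-sum (λ p → sumTuplesₚ k (f ∘ (p ∷_))) x)
          (sum-cong-≋ {m} λ p → substitute-sumTuplesₚ k (f ∘ (p ∷_)) x)

  module _ {Γ : RankedAlphabet} (𝓐 : WFTA S Γ) where

    open WFTA 𝓐

    -- The state behavior of `𝓐` run symbolically: the unknown weight in state `q` of the tree to be
    -- plugged in is the indeterminate `q`. The variable may occur any number of times, hence
    -- polynomials of arbitrary degree instead of linear forms.
    contextPolynomial : Tree Γ 1 → Fin states → Polynomial S states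
    childPolynomial   : ∀ {k} → Vec (Tree Γ 1) k → Vec (Fin states) k → Polynomial S states

    contextPolynomial (var _)     q = indeterminate q
    contextPolynomial (node g ts) q =
      sumTuplesₚ (rank Γ g) (λ ps → constant (δ g ps q) ℙ.* childPolynomial ts ps)

    childPolynomial []       []       = ℙ.1#
    childPolynomial (t ∷ ts) (p ∷ ps) = contextPolynomial t p ℙ.* childPolynomial ts ps

    -- Mutual induction on the context and its children: each operation that builds the polynomial
    -- commutes with substitution and mirrors a clause of `stateBehavior` or `childProduct`.
    substitute-contextPolynomial : ∀ t u q →
      contextPolynomial t q ⟪ stateBehavior u ⟫ ≈ stateBehavior (t ⟨ u ∷ [] ⟩) q
    substitute-childPolynomial : ∀ {k} (ts : Vec (Tree Γ 1) k) u ps →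
      childPolynomial ts ps ⟪ stateBehavior u ⟫ ≈ childProduct (ts ⟨ u ∷ [] ⟩*) ps

    substitute-contextPolynomial (var zero)  u q = substitute-indeterminate q (stateBehavior u)
    substitute-contextPolynomial (node g ts) u q =
      trans (substitute-sumTuplesₚ (rank Γ g) (λ ps → constant (δ g ps q) ℙ.* childPolynomial ts ps) x)
            (sumTuples-cong (rank Γ g) λ ps →
              trans (substitute-* (constant (δ g ps q)) (childPolynomial ts ps) x)
                    (*-cong (substitute-constant _ x) (substitute-childPolynomial ts u ps)))
      where x = stateBehavior u

    substitute-childPolynomial []       u []       = substitute-constant 1# (stateBehavior u)
    substitute-childPolynomial (t ∷ ts) u (p ∷ ps) =
      trans (substitute-* (contextPolynomial t p) (childPolynomial ts ps) (stateBehavior u))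
            (*-cong (substitute-contextPolynomial t u p) (substitute-childPolynomial ts u ps))

    module _ {Σ : Alphabet} (h : TreeHomomorphism (Σ ^1#) Γ) where

      open TreeHomomorphism h using (image; homomorphic)

      pullback : WAFA S Σ
      pullback = record
        { δ  = λ q a → contextPolynomial (image (just a)) q
        ; P₀ = ℙ.sum (λ q → constant (final q) ℙ.* indeterminate q)
        ; τ  = stateBehavior (apply h (wordTree Σ []))
        }

      pullback-stateBehavior : ∀ w q →
        WAFA.stateBehavior pullback w q ≈ stateBehavior (apply h (wordTree Σ w)) q
      pullback-stateBehavior []      q = refl
      pullback-stateBehavior (a ∷ w) q = begin
        contextPolynomial (image (just a)) q ⟪ WAFA.stateBehavior pullback w ⟫
          ≈⟨ substitute-cong (contextPolynomial (image (just a)) q) (pullback-stateBehavior w) ⟩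
        contextPolynomial (image (just a)) q ⟪ stateBehavior (apply h (wordTree Σ w)) ⟫
          ≈⟨ substitute-contextPolynomial (image (just a)) (apply h (wordTree Σ w)) q ⟩
        stateBehavior (image (just a) ⟨ apply h (wordTree Σ w) ∷ [] ⟩) q
          ≡⟨ ≡.cong (λ t → stateBehavior t q) (homomorphic (just a) (wordTree Σ w ∷ [])) ⟨
        stateBehavior (apply h (wordTree Σ (a ∷ w))) q
          ∎

      pullback-behavior : SameLanguage S Σ (WAFA.behavior pullback) (behavior ∘ apply h ∘ wordTree Σ)
      pullback-behavior w =
        trans (substitute-sum (λ q → constant (final q) ℙ.* indeterminate q) x)
              (sum-cong-≋ {states} λ q →
                trans (substitute-* (constant (final q)) (indeterminate q) x)
                      (*-cong (substitute-constant _ x)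
                              (trans (substitute-indeterminate q x) (pullback-stateBehavior w q))))
        where x = WAFA.stateBehavior pullback w

  -- From alternating automata to tree automata

  module _ {Σ : Alphabet} (𝓐 : WAFA S Σ) where

    open WAFA 𝓐

    private
      shift : Polynomial S states → Polynomial S (suc (suc states))
      shift p = p ⊙ (λ q → indeterminate (suc (suc q)))

      substitute-shift : ∀ p x → shift p ⟪ x ⟫ ≈ p ⟪ (λ q → x (suc (suc q))) ⟫
      substitute-shift p x =
        trans (substitute-⊙ p _ x)
              (substitute-cong p λ q → substitute-indeterminate (suc (suc q)) x)

    -- State 0 is ⊥ and state 1 carries the behavior; the states of 𝓐 follow.
    extension : WAFA S Σ
    extension = record
      { states = suc (suc states)
      ; δ      = λ { zero          a → ℙ.1#
                   ; (suc zero)    a → shift (P₀ ⊙ (λ q → δ q a))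
                   ; (suc (suc q)) a → shift (δ q a)
                   }
      ; P₀     = indeterminate (suc zero)
      ; τ      = λ { zero          → 1#
                   ; (suc zero)    → P₀ ⟪ τ ⟫
                   ; (suc (suc q)) → τ q
                   }
      }

    extension-unit : ∀ w → WAFA.stateBehavior extension w zero ≈ 1#
    extension-unit []      = refl
    extension-unit (a ∷ w) = substitute-constant 1# (WAFA.stateBehavior extension w)

    extension-state : ∀ w q → WAFA.stateBehavior extension w (suc (suc q)) ≈ stateBehavior w q
    extension-state []      q = refl
    extension-state (a ∷ w) q =
      trans (substitute-shift (δ q a) (WAFA.stateBehavior extension w))
            (substitute-cong (δ q a) (extension-state w))

    -- A tree automaton can only weigh states linearly at the root, so the value of `P₀` has to be
    -- the weight of a single state. A case split on the word suffices: on `a ∷ w` the composite of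
    -- `P₀` with the transitions for `a` reads only weights at `w`, which `extension-state`
    -- supplies.
    extension-start : ∀ w → WAFA.stateBehavior extension w (suc zero) ≈ behavior w
    extension-start []      = refl
    extension-start (a ∷ w) = begin
      shift (P₀ ⊙ δₐ) ⟪ x ⟫                    ≈⟨ substitute-shift (P₀ ⊙ δₐ) x ⟩
      (P₀ ⊙ δₐ) ⟪ x′ ⟫                         ≈⟨ substitute-⊙ P₀ δₐ x′ ⟩
      P₀ ⟪ (λ q → δₐ q ⟪ x′ ⟫) ⟫               ≈⟨ substitute-cong P₀ (λ q → substitute-cong (δₐ q) (extension-state w)) ⟩
      P₀ ⟪ (λ q → δₐ q ⟪ stateBehavior w ⟫) ⟫  ∎
      where
      δₐ : Fin states → Polynomial S states
      δₐ q = δ q a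
      x : Fin (suc (suc states)) → Carrier
      x = WAFA.stateBehavior extension w
      x′ : Fin states → Carrier
      x′ q = x (suc (suc q))

  -- Monomials unrolled into lists of states

  factors : ∀ {n} → Vec ℕ n → List (Fin n)
  factors e = concat (List.tabulate (λ i → List.replicate (lookup e i) i))

  private
    prod : ∀ {n} → (Fin n → Carrier) → List (Fin n) → Carrier
    prod x = foldr (λ i r → x i * r) 1#

  prod-++ : ∀ {n} (x : Fin n → Carrier) is js → prod x (is ++ js) ≈ prod x is * prod x js
  prod-++ x []       js = sym (*-identityˡ _)
  prod-++ x (i ∷ is) js = trans (*-congˡ (prod-++ x is js)) (sym (*-assoc _ _ _))

  prod-replicate : ∀ {n} (x : Fin n → Carrier) d i → prod x (List.replicate d i) ≈ x i ^ d
  prod-replicate x zero    i = refl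
  prod-replicate x (suc d) i = *-congˡ (prod-replicate x d i)

  prod-concat-tabulate : ∀ {m n} (x : Fin n → Carrier) (f : Fin m → List (Fin n)) →
                         prod x (concat (List.tabulate f)) ≈ product (λ i → prod x (f i))
  prod-concat-tabulate {zero}  x f = refl
  prod-concat-tabulate {suc m} x f =
    trans (prod-++ x (f zero) _) (*-congˡ (prod-concat-tabulate x (f ∘ suc)))

  -- The bridge between the two kinds of automata: a power product in a WAFA transition becomes a
  -- product with one factor per child, as in a tree automaton.
  prod-factors : ∀ {n} (x : Fin n → Carrier) e → prod x (factors e) ≈ power e x
  prod-factors {n} x e =
    trans (prod-concat-tabulate {n} x _) (Product.sum-cong-≋ {n} λ i → prod-replicate x (lookup e i) i)

  -- Simulation by a tree automaton on copied subtrees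

  module _ {Σ : Alphabet} (𝓑 : WAFA S Σ) (⊥ : Fin (WAFA.states 𝓑)) where

    open WAFA 𝓑

    -- Factors beyond the first k are dropped.
    pad : ∀ k → List (Fin states) → Vec (Fin states) k
    pad zero    _        = []
    pad (suc k) []       = ⊥ ∷ pad k []
    pad (suc k) (i ∷ is) = i ∷ pad k is

    -- The coefficients of all terms whose padded list of factors is exactly `ps` are added up, so
    -- repeated exponent vectors accumulate.
    coefficient : ∀ {k} → Polynomial S states → Vec (Fin states) k → Carrier
    coefficient p ps = foldr (λ (s , e) r → s * indicators ps (pad _ (factors e)) + r) 0# p

    -- The sum over tuples is exchanged with the sum over terms, and the delta of each term keeps
    -- only its own padded tuple. This holds for every `k`, even where `pad` truncates.
    sumTuples-coefficient : ∀ {k} p (f : Vec (Fin states) k → Carrier) →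
      sumTuples S k (λ ps → coefficient p ps * f ps) ≈
      foldr (λ (s , e) r → s * f (pad k (factors e)) + r) 0# p
    sumTuples-coefficient {k} []            f =
      trans (sumTuples-cong k λ ps → zeroˡ (f ps)) (sumTuples-0 k)
    sumTuples-coefficient {k} ((s , e) ∷ p) f = begin
      sumTuples S k (λ ps → (s * indicators ps v + coefficient p ps) * f ps)
        ≈⟨ sumTuples-cong k (λ ps → trans (distribʳ _ _ _) (+-congʳ (*-assoc _ _ _))) ⟩
      sumTuples S k (λ ps → s * (indicators ps v * f ps) + coefficient p ps * f ps)
        ≈⟨ sumTuples-+ k _ _ ⟩
      sumTuples S k (λ ps → s * (indicators ps v * f ps)) +
      sumTuples S k (λ ps → coefficient p ps * f ps)
        ≈⟨ +-cong (sym (*-distribˡ-sumTuples k s _)) (sumTuples-coefficient p f) ⟩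
      s * sumTuples S k (λ ps → indicators ps v * f ps) + rest
        ≈⟨ +-congʳ (*-congˡ (sumTuples-indicators v f)) ⟩
      s * f v + rest
        ∎
      where
      v    = pad k (factors e)
      rest = foldr (λ (s , e) r → s * f (pad k (factors e)) + r) 0# p

    degree : Monomial states → ℕ
    degree (s , e) = length (factors e)

    -- The rank of a letter cannot depend on the state, so one bound covers the terms of every
    -- `δ q a`.
    arity : Symbol Σ → ℕ
    arity a = max 0 (List.map degree (concat (List.tabulate (λ q → δ q a))))

    degree≤arity : ∀ q a → All (λ m → degree m ≤ arity a) (δ q a)
    degree≤arity q a = All.tabulate⁻ {f = λ q → δ q a} (All.concat⁻ (All.map⁻ (xs≤max 0 _))) q

    copyRank : Symbol (RankedAlphabet.alphabet (Σ ^1#)) → ℕ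
    copyRank nothing  = 0
    copyRank (just a) = arity a

    copyAlphabet : RankedAlphabet
    copyAlphabet = record { alphabet = RankedAlphabet.alphabet (Σ ^1#) ; rank = copyRank }

    -- A letter of arity 0 becomes a leaf and forgets the rest of the word; this is consistent
    -- because all its transition polynomials are then constant.
    copies : GroundTree (Σ ^1#) → GroundTree copyAlphabet
    copies (node nothing  [])       = node nothing []
    copies (node (just a) (t ∷ [])) = node (just a) (replicate _ (copies t))

    replicate-⟨⟩* : ∀ {m n} k (t : Tree copyAlphabet m) (us : Vec (Tree copyAlphabet n) m) →
                    replicate k t ⟨ us ⟩* ≡ replicate k (t ⟨ us ⟩)
    replicate-⟨⟩* zero    t us = ≡.refl
    replicate-⟨⟩* (suc k) t us = ≡.cong (t ⟨ us ⟩ ∷_) (replicate-⟨⟩* k t us)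

    copyHomomorphism : TreeHomomorphism (Σ ^1#) copyAlphabet
    copyHomomorphism = record
      { apply       = copies
      ; image       = λ { nothing  → node nothing []
                        ; (just a) → node (just a) (replicate _ (var zero))
                        }
      ; homomorphic = λ { nothing  []       → ≡.refl
                        ; (just a) (t ∷ []) → ≡.cong (node (just a))
                            (≡.sym (replicate-⟨⟩* (arity a) (var zero) (copies t ∷ [])))
                        }
      }

    copyAutomaton : (Fin states → Carrier) → WFTA S copyAlphabet
    copyAutomaton λ′ = record
      { δ     = λ { nothing  ps q → τ q
                  ; (just a) ps q → coefficient (δ q a) ps
                  }
      ; final = λ′
      }

    module _ (λ′ : Fin states → Carrier) where

      private
        module 𝓒 = WFTA (copyAutomaton λ′)

      -- The length bound guarantees that `pad` drops no factor, and every slot filled with `⊥`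
      -- contributes the weight 1.
      childProduct-pad : ∀ k t is → 𝓒.stateBehavior t ⊥ ≈ 1# → length is ≤ k →
        𝓒.childProduct (replicate k t) (pad k is) ≈ prod (𝓒.stateBehavior t) is
      childProduct-pad zero    t []       ⊥≈1 _         = refl
      childProduct-pad (suc k) t []       ⊥≈1 _         =
        trans (*-cong ⊥≈1 (childProduct-pad k t [] ⊥≈1 z≤n)) (*-identityˡ 1#)
      childProduct-pad (suc k) t (i ∷ is) ⊥≈1 (s≤s is≤) = *-congˡ (childProduct-pad k t is ⊥≈1 is≤)

      substitute-pad : ∀ k t p → 𝓒.stateBehavior t ⊥ ≈ 1# → All (λ m → degree m ≤ k) p →
        foldr (λ (s , e) r → s * 𝓒.childProduct (replicate k t) (pad k (factors e)) + r) 0# p ≈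
        p ⟪ 𝓒.stateBehavior t ⟫
      substitute-pad k t []            ⊥≈1 []          = refl
      substitute-pad k t ((s , e) ∷ p) ⊥≈1 (e≤k ∷ p≤k) =
        +-cong (*-congˡ (trans (childProduct-pad k t (factors e) ⊥≈1 e≤k) (prod-factors _ e)))
               (substitute-pad k t p ⊥≈1 p≤k)

      -- One letter of the simulation: the sum over child states collapses to the terms of `δ q a`,
      -- and `degree≤arity` lets padding recover each monomial. Keeping `t` and `x` general lets the
      -- induction on words supply them.
      copyAutomaton-step : ∀ t {x : Fin states → Carrier} →
        (∀ q → 𝓒.stateBehavior t q ≈ x q) → x ⊥ ≈ 1# → ∀ q a →
        𝓒.stateBehavior (node (just a) (replicate _ t)) q ≈ δ q a ⟪ x ⟫
      copyAutomaton-step t {x} t≈x x⊥≈1 q a = begin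
        sumTuples S k (λ ps → coefficient (δ q a) ps * 𝓒.childProduct (replicate k t) ps)
          ≈⟨ sumTuples-coefficient (δ q a) (𝓒.childProduct (replicate k t)) ⟩
        foldr (λ (s , e) r → s * 𝓒.childProduct (replicate k t) (pad k (factors e)) + r) 0# (δ q a)
          ≈⟨ substitute-pad k t (δ q a) (trans (t≈x ⊥) x⊥≈1) (degree≤arity q a) ⟩
        δ q a ⟪ 𝓒.stateBehavior t ⟫
          ≈⟨ substitute-cong (δ q a) t≈x ⟩
        δ q a ⟪ x ⟫
          ∎
        where k = arity a

      copyAutomaton-stateBehavior : (∀ w → stateBehavior w ⊥ ≈ 1#) → ∀ w q →
        𝓒.stateBehavior (copies (wordTree Σ w)) q ≈ stateBehavior w q
      -- The end marker has the empty tuple of children, so its weight is `τ q` times an empty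
      -- product.
      copyAutomaton-stateBehavior ⊥≈1 []      q = *-identityʳ (τ q)
      copyAutomaton-stateBehavior ⊥≈1 (a ∷ w) q =
        copyAutomaton-step (copies (wordTree Σ w)) (copyAutomaton-stateBehavior ⊥≈1 w) (⊥≈1 w) q a

theorem4p5 : ∀ {c ℓ} (S : CommutativeSemiring c ℓ) (Σ : Alphabet) (s : WeightedLanguage S Σ) →
    (Σ[ 𝓐 ∈ WAFA S Σ ] Recognizes S 𝓐 s)
    ⇔
    (Σ[ Γ ∈ RankedAlphabet ] Σ[ h ∈ TreeHomomorphism (Σ ^1#) Γ ] Σ[ 𝓐 ∈ WFTA S Γ ]
    SameLanguage S Σ s (WFTA.behavior 𝓐 ∘ apply h ∘ wordTree Σ))
theorem4p5 S Σ s = mk⇔ to from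
  where
  open CommutativeSemiring S using (sym; trans)

  to : _ → _
  to (𝓐 , 𝓐≈s) =
    -- The argument `zero` is the state of constant weight 1 in `extension`, used for padding. The
    -- final weights are the delta at `suc zero`, so the sum at the root reduces to the weight of
    -- the state that carries the behavior.
    copyAlphabet S 𝓑 zero , copyHomomorphism S 𝓑 zero , 𝓒 , λ w → sym
      (trans (sum-indicator S (suc zero) (WFTA.stateBehavior 𝓒 (copies S 𝓑 zero (wordTree Σ w))))
      (trans (copyAutomaton-stateBehavior S 𝓑 zero _ (extension-unit S 𝓐) w (suc zero))
      (trans (extension-start S 𝓐 w) (𝓐≈s w))))
    where
    𝓑 = extension S 𝓐
    𝓒 = copyAutomaton S 𝓑 zero (λ q → indicator S q (suc zero))

  from : _ → _
  from (Γ , h , 𝓐 , s≈𝓐h) =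
    pullback S 𝓐 h , λ w → trans (pullback-behavior S 𝓐 h w) (sym (s≈𝓐h w))
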